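{- Let $G$ be the tree with vertices $A, C_1, C_2, C_3, A', C'_1, C'_2, C'_3$ and the seven edges $C_3C'_3$, $AC_i$, $A'C'_i$ for $i=1,2,3$. Let $H$ be the tree with vertices $B, D, P_1, P_2, P_3, Q_1, Q_2, Q_3$ and the seven edges $BD$, $BP_i$, $P_iQ_i$ for $i=1,2,3$. Then $G$ and $H$ are unfriendly, i.e. there is no realizable bijection from the set of edges of $G$ to the set of edges of $H$.
   Context: Let $Y$ be a tree and let $p, q$ be sets of edges of $Y$. The set $p$ is on the same side of $q$ (in $Y$) if $p\cap q=\emptyset$ and for any two vertices that are endpoints of edges of $p$, the path in $Y$ connecting these two vertices contains an even number of edges of $q$. The sets $p$ and $q$ are unlinked (in $Y$) if $p$ is on the same side of $q$ and $q$ is on the same side of $p$. For a vertex $P$ of a graph, $\delta P$ denotes the set of all edges having $P$ as an endpoint. Let $K, K'$ be trees with the same number of edges and let $h$ be a bijection from the edges of $K$ to the edges of $K'$. Then $h$ is realizable if for any two distinct vertices $A, B$ of $K$ such that the path in $K$ joining $A$ and $B$ contains an even number of edges, the edge sets $h(\delta A)$ and $h(\delta B)$ are unlinked in $K'$. The trees $K$ and $K'$ are friendly if such a realizable bijection exists, and unfriendly otherwise. -}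

module Defs where

open import Data.Nat using (ℕ; _*_)
open import Data.Nat.Divisibility using (_∣_)
open import Data.Fin using (Fin; zero; suc; _≟_; #_)
open import Data.Fin.Properties using (any?)
open import Data.Fin.Subset using (Subset; _∈_; _∩_; Empty)
open import Data.Fin.Subset.Properties using (_∈?_)
open import Data.Bool using (Bool; _∨_)
open import Data.Vec using (Vec; tabulate; []; _∷_)
open import Data.List using (List; length; filter; []; _∷_)
open import Data.List.Relation.Unary.Unique.Propositional using (Unique)
open import Data.Product using (Σ; ∃; _×_; _,_; proj₁; proj₂)
open import Data.Sum using (_⊎_)
open import Relation.Binary.PropositionalEquality using (_≡_; _≢_)
open import Relation.Nullary using (¬_)
open import Relation.Nullary.Decidable using (⌊_⌋; _×-dec_)
open import Function.Definitions using (Bijective)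

record Graph : Set where
  field
    V    : ℕ
    E    : ℕ
    ends : Fin E → Fin V × Fin V
open Graph public

Joins : (G : Graph) → Fin (E G) → Fin (V G) → Fin (V G) → Set
Joins G e u w = (ends G e ≡ (u , w)) ⊎ (ends G e ≡ (w , u))

data Walk (G : Graph) : Fin (V G) → Fin (V G) → List (Fin (V G)) → List (Fin (E G)) → Set where
  stop : ∀ {u} → Walk G u u (u ∷ []) []
  step : ∀ {u w v vs es} (e : Fin (E G)) → Joins G e u w → Walk G w v vs es →
         Walk G u v (u ∷ vs) (e ∷ es)

-- A path: a walk without repeated vertices (in a tree it is unique between two vertices).
IsPath : (G : Graph) → Fin (V G) → Fin (V G) → List (Fin (V G)) → List (Fin (E G)) → Set
IsPath G u v vs es = Walk G u v vs es × Unique vs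

count : ∀ {m} → Subset m → List (Fin m) → ℕ
count q es = length (filter (_∈? q) es)

EvenN : ℕ → Set
EvenN n = 2 ∣ n

EndpointOf : (G : Graph) → Subset (E G) → Fin (V G) → Set
EndpointOf G p u = ∃ λ e → e ∈ p × (proj₁ (ends G e) ≡ u ⊎ proj₂ (ends G e) ≡ u)

SameSide : (G : Graph) → Subset (E G) → Subset (E G) → Set
SameSide G p q =
  Empty (p ∩ q) ×
  (∀ u v → EndpointOf G p u → EndpointOf G p v →
     ∀ vs es → IsPath G u v vs es → EvenN (count q es))

Unlinked : (G : Graph) → Subset (E G) → Subset (E G) → Set
Unlinked G p q = SameSide G p q × SameSide G q p

δ : (G : Graph) → Fin (V G) → Subset (E G)
δ G P = tabulate λ e → ⌊ proj₁ (ends G e) ≟ P ⌋ ∨ ⌊ proj₂ (ends G e) ≟ P ⌋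

image : ∀ {m n} → (Fin m → Fin n) → Subset m → Subset n
image h S = tabulate λ e' → ⌊ any? (λ e → (e ∈? S) ×-dec (h e ≟ e')) ⌋

Realizable : (K K' : Graph) → (Fin (E K) → Fin (E K')) → Set
Realizable K K' h =
  ∀ (A B : Fin (V K)) → A ≢ B →
  ∀ vs es → IsPath K A B vs es → EvenN (length es) →
  Unlinked K' (image h (δ K A)) (image h (δ K B))

Friendly : Graph → Graph → Set
Friendly K K' = Σ (Fin (E K) → Fin (E K')) λ h → Bijective _≡_ _≡_ h × Realizable K K' h

Unfriendly : Graph → Graph → Set
Unfriendly K K' = ¬ Friendly K K'

-- G: vertices A=0, C1=1, C2=2, C3=3, A'=4, C'1=5, C'2=6, C'3=7
-- edges: C3C'3, AC1, AC2, AC3, A'C'1, A'C'2, A'C'3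
Gends : Fin 7 → Fin 8 × Fin 8
Gends zero = (# 3 , # 7)
Gends (suc zero) = (# 0 , # 1)
Gends (suc (suc zero)) = (# 0 , # 2)
Gends (suc (suc (suc zero))) = (# 0 , # 3)
Gends (suc (suc (suc (suc zero)))) = (# 4 , # 5)
Gends (suc (suc (suc (suc (suc zero))))) = (# 4 , # 6)
Gends (suc (suc (suc (suc (suc (suc zero)))))) = (# 4 , # 7)

Gtree : Graph
Gtree = record { V = 8 ; E = 7 ; ends = Gends }

-- H: vertices B=0, D=1, P1=2, P2=3, P3=4, Q1=5, Q2=6, Q3=7
-- edges: BD, BP1, BP2, BP3, P1Q1, P2Q2, P3Q3
Hends : Fin 7 → Fin 8 × Fin 8
Hends zero = (# 0 , # 1)
Hends (suc zero) = (# 0 , # 2)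
Hends (suc (suc zero)) = (# 0 , # 3)
Hends (suc (suc (suc zero))) = (# 0 , # 4)
Hends (suc (suc (suc (suc zero)))) = (# 2 , # 5)
Hends (suc (suc (suc (suc (suc zero))))) = (# 3 , # 6)
Hends (suc (suc (suc (suc (suc (suc zero)))))) = (# 4 , # 7)

Htree : Graph
Htree = record { V = 8 ; E = 7 ; ends = Hends }

{-# OPTIONS --safe #-}
-- Write BD, xᵢ = BPᵢ and yᵢ = PᵢQᵢ for the edges of H.  Fix one of the two sides of the bipartition
-- of G and, through h, colour every edge of H by the endpoint of its preimage on that side.  Two
-- vertices of the same side are at even distance, so realizability applies to any two distinct
-- colours.  The paths of H from Pᵢ to B (crossing xᵢ) and from Pᵢ to Pⱼ (crossing xᵢ and xⱼ) then give
--   * if yᵢ has the colour of BD or of some xⱼ with j ≠ i, then xᵢ has it too;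
--   * if yᵢ and yⱼ have the same colour, then so do xᵢ and xⱼ.
-- No bijective labelling of the edges of H by those of G satisfies this for both sides, which is
-- checked exhaustively, leg (xᵢ , yᵢ) by leg.
module Submission where

open import Defs
open import Data.Empty using (⊥)
open import Data.Fin using (Fin; suc; #_; _≟_; _↑ˡ_; _↑ʳ_)
open import Data.Fin.Patterns using (0F; 1F; 2F)
open import Data.Fin.Properties using (all?; any?)
open import Data.Fin.Subset using (Subset; _∈_; _∉_)
open import Data.Fin.Subset.Properties using (_∈?_)
open import Data.List using (List; []; _∷_; length; allFin; foldr)
open import Data.List.Properties using (filter-accept; filter-reject)
open import Data.List.Relation.Unary.All as All using ([]; _∷_)
open import Data.List.Relation.Unary.AllPairs using ([]; _∷_)
open import Data.List.Relation.Unary.Unique.Propositional using (Unique)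
open import Data.List.Relation.Unary.Unique.Propositional.Properties using (map⁺)
open import Data.List.Relation.Unary.Unique.DecPropositional (_≟_ {7}) using (unique?)
open import Data.Maybe using (Maybe; just; nothing; _<∣>_; _>>=_) renaming (map to mapᴹ)
open import Data.Maybe.Relation.Unary.Any as Any using ()
open import Data.Nat using (ℕ; zero; suc)
open import Data.Nat.Divisibility using (_∣?_)
open import Data.Product using (∃; ∃₂; _×_; _,_; proj₁; proj₂)
open import Data.Sum using (inj₁; inj₂)
open import Data.Vec using (lookup; _∷_; [])
open import Data.Vec.Properties using (lookup∘tabulate; []=⇒lookup; lookup⇒[]=)
open import Function using (_∘_)
open import Relation.Binary.PropositionalEquality
  using (_≡_; _≢_; refl; sym; trans; cong; subst; ≢-sym)
open import Relation.Nullary using (¬_; Dec; yes; no)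
open import Relation.Nullary.Decidable
  using (⌊_⌋; isYes≗does; dec-true; from-yes; from-no; dec⇒maybe; ¬?;
         decidable-stable; _×-dec_; _→-dec_)

-- Images under a bijection

module _ {m n} {h : Fin m → Fin n} {g : Fin n → Fin m}
         (h-injective : ∀ {e f} → h e ≡ h f → e ≡ f) (h∘g : ∀ f → h (g f) ≡ f)
         (S : Subset m) (f : Fin n) where

  private
    hit? : ∀ f → Dec (∃ λ e → e ∈ S × h e ≡ f)
    hit? f = any? λ e → (e ∈? S) ×-dec (h e ≟ f)

  ∈-image⁺ : g f ∈ S → f ∈ image h S
  ∈-image⁺ gf∈S = lookup⇒[]= f (image h S)
    (trans (lookup∘tabulate (⌊_⌋ ∘ hit?) f)
      (trans (isYes≗does (hit? f)) (dec-true (hit? f) (g f , gf∈S , h∘g f))))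

  -- Injectivity of `h` forces any witness for `f` to be `g f`, so membership can be tested in G.
  ∈-image⁻ : f ∈ image h S → g f ∈ S
  ∈-image⁻ f∈ with hit? f | trans (sym (lookup∘tabulate (⌊_⌋ ∘ hit?) f)) ([]=⇒lookup f∈)
  ... | yes (e , e∈S , he≡f) | _  = subst (_∈ S) (h-injective (trans he≡f (sym (h∘g f)))) e∈S
  ... | no _                 | ()

-- Searching for paths

Path : (G : Graph) → Fin (V G) → Fin (V G) → Set
Path G u v = ∃₂ λ vs es → IsPath G u v vs es

edges : ∀ {G u v} → Path G u v → List (Fin (E G))
edges (_ , es , _) = es

module _ (G : Graph) where

  neighbour : ∀ u e → Maybe (∃ λ w → Joins G e u w)
  neighbour u e with ends G e
  ... | a , b with a ≟ u | b ≟ u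
  ...   | yes refl | _        = just (b , inj₁ refl)
  ...   | no _     | yes refl = just (a , inj₂ refl)
  ...   | no _     | no _     = nothing

  extend : ∀ {u w v} e → Joins G e u w → Path G w v → Maybe (Path G u v)
  extend {u} e j (vs , es , walk , unique) =
    mapᴹ (λ fresh → u ∷ vs , e ∷ es , step e j walk , fresh ∷ unique)
         (dec⇒maybe (All.all? (λ x → ¬? (u ≟ x)) vs))

  -- Only one path from each neighbour is tried, so the search is complete only on trees.
  findPath : ℕ → ∀ u v → Maybe (Path G u v)
  findPath n u v with u ≟ v
  ... | yes refl = just (u ∷ [] , [] , stop , [] ∷ [])
  findPath zero    u v | no _ = nothing
  findPath (suc n) u v | no _ = foldr (λ e found → via e <∣> found) nothing (allFin (E G))
    where
    via : ∀ e → Maybe (Path G u v)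
    via e = neighbour u e >>= λ (w , j) → findPath n w v >>= extend e j

-- The bipartition of G

side : Fin 8 → Fin 2
side = lookup (0F ∷ 1F ∷ 1F ∷ 1F ∷ 1F ∷ 0F ∷ 0F ∷ 0F ∷ [])

-- Every edge of G joins the sides A, C'₁, C'₂, C'₃ (`0F`) and C₁, C₂, C₃, A' (`1F`), so if its
-- first endpoint is off side `s`, the second lies on it.
end : Fin 2 → Fin 7 → Fin 8
end s e with side (proj₁ (Gends e)) ≟ s
... | yes _ = proj₁ (Gends e)
... | no _  = proj₂ (Gends e)

side-end : ∀ s e → side (end s e) ≡ s
side-end = from-yes (all? λ s → all? λ e → side (end s e) ≟ s)

∈δ-end : ∀ s e → e ∈ δ Gtree (end s e)
∈δ-end = from-yes (all? λ s → all? λ e → e ∈? δ Gtree (end s e))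

end-unique : ∀ v e → e ∈ δ Gtree v → end (side v) e ≡ v
end-unique = from-yes (all? λ v → all? λ e → (e ∈? δ Gtree v) →-dec (end (side v) e ≟ v))

-- The largest even distance in G is 4.
same-side⇒even-path : ∀ u v → side u ≡ side v →
                      ∃ λ (p : Path Gtree u v) → EvenN (length (edges {Gtree} p))
same-side⇒even-path u v = Any.satisfied ∘ found u v
  where
  even? : ∀ {u v} (p : Path Gtree u v) → Dec (EvenN (length (edges {Gtree} p)))
  even? p = 2 ∣? _
  found = from-yes (all? λ u → all? λ v →
    (side u ≟ side v) →-dec Any.dec even? (findPath Gtree 4 u v))

-- The legs of H and the paths between them

vB : Fin 8
vB = # 0

-- The shift by 2 exposes constructors even for variable `i`, so `λ ()` can separate `vP i` from
-- `vB`.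
vP : Fin 3 → Fin 8
vP i = 2 ↑ʳ (i ↑ˡ 3)

BD : Fin 7
BD = # 0

x y : Fin 3 → Fin 7
x i = suc (i ↑ˡ 3)
y i = suc (3 ↑ʳ i)

x-ends : ∀ i → Hends (x i) ≡ (vB , vP i)
x-ends 0F = refl
x-ends 1F = refl
x-ends 2F = refl

y-left : ∀ i → proj₁ (Hends (y i)) ≡ vP i
y-left = from-yes (all? λ i → proj₁ (Hends (y i)) ≟ vP i)

vP-injective : ∀ i j → vP i ≡ vP j → i ≡ j
vP-injective = from-yes (all? λ i → all? λ j → (vP i ≟ vP j) →-dec (i ≟ j))

vP→vB : ∀ i → IsPath Htree (vP i) vB (vP i ∷ vB ∷ []) (x i ∷ [])
vP→vB i = step (x i) (inj₂ (x-ends i)) stop , ((λ ()) ∷ []) ∷ [] ∷ []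

vP→vP : ∀ {i j} → i ≢ j →
        IsPath Htree (vP i) (vP j) (vP i ∷ vB ∷ vP j ∷ []) (x i ∷ x j ∷ [])
vP→vP {i} {j} i≢j =
  step (x i) (inj₂ (x-ends i)) (step (x j) (inj₁ (x-ends j)) stop) ,
  ((λ ()) ∷ (i≢j ∘ vP-injective i j) ∷ []) ∷ ((λ ()) ∷ []) ∷ [] ∷ []

-- From crossing parities to constraints on labellings

¬even-1 : ¬ EvenN 1
¬even-1 = from-no (2 ∣? 1)

count-∈ : ∀ {m} {q : Subset m} {e} → e ∈ q → count q (e ∷ []) ≡ 1
count-∈ {q = q} e∈q = cong length (filter-accept (_∈? q) e∈q)

count-∈-∉ : ∀ {m} {q : Subset m} {e f} → e ∈ q → f ∉ q → count q (e ∷ f ∷ []) ≡ 1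
count-∈-∉ {q = q} {e} e∈q f∉q = trans
  (cong length (filter-accept (_∈? q) e∈q))
  (cong (suc ∘ length) (filter-reject (_∈? q) f∉q))

-- The arguments are edges of G serving as labels: `x` and `y` of a leg of H, `f` of another edge at
-- B.
Inward : Fin 7 → Fin 7 → Fin 7 → Set
Inward x y f = ∀ s → end s y ≡ end s f → end s x ≡ end s y

Parallel : Fin 7 → Fin 7 → Fin 7 → Fin 7 → Set
Parallel x y x′ y′ = ∀ s → end s y ≡ end s y′ → end s x ≡ end s x′

Legs : (x y x′ y′ : Fin 7) → Set
Legs x y x′ y′ = Unique (x ∷ y ∷ x′ ∷ y′ ∷ []) ×
  Inward x y x′ × Inward x′ y′ x × Parallel x y x′ y′

Stem : (d x y : Fin 7) → Set
Stem d x y = Unique (d ∷ x ∷ y ∷ []) × Inward x y d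

inward? : ∀ x y f → Dec (Inward x y f)
inward? x y f = all? λ s → (end s y ≟ end s f) →-dec (end s x ≟ end s y)

legs? : ∀ x y x′ y′ → Dec (Legs x y x′ y′)
legs? x y x′ y′ = unique? _ ×-dec inward? x y x′ ×-dec inward? x′ y′ x ×-dec
  (all? λ s → (end s y ≟ end s y′) →-dec (end s x ≟ end s x′))

stem? : ∀ d x y → Dec (Stem d x y)
stem? d x y = unique? _ ×-dec inward? x y d

-- Hypotheses and quantifiers alternate to prune the search: a failed check on two legs settles the
-- implication before the third leg or BD is enumerated.
no-labelling : ∀ x₁ y₁ x₂ y₂ → Legs x₁ y₁ x₂ y₂ →
               ∀ x₃ y₃ → Legs x₁ y₁ x₃ y₃ → Legs x₂ y₂ x₃ y₃ →
               ∀ d → Stem d x₁ y₁ → Stem d x₂ y₂ → ¬ Stem d x₃ y₃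
no-labelling = from-yes
  (all? λ x₁ → all? λ y₁ → all? λ x₂ → all? λ y₂ → legs? x₁ y₁ x₂ y₂ →-dec
  (all? λ x₃ → all? λ y₃ → legs? x₁ y₁ x₃ y₃ →-dec (legs? x₂ y₂ x₃ y₃ →-dec
  (all? λ d → stem? d x₁ y₁ →-dec (stem? d x₂ y₂ →-dec ¬? (stem? d x₃ y₃))))))

-- The colour classes are kept abstract, since the type checker would otherwise unfold images.
module _ (g : Fin 7 → Fin 7) (g-injective : ∀ {e f} → g e ≡ g f → e ≡ f)
         (class : Fin 8 → Subset 7)
         (∈-class : ∀ s f → f ∈ class (end s (g f)))
         (class-unique : ∀ A f → f ∈ class A → end (side A) (g f) ≡ A)
         (same-side : ∀ A B → side A ≡ side B → A ≢ B → SameSide Htree (class A) (class B)) where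

  private
    colour : Fin 2 → Fin 7 → Fin 8
    colour s f = end s (g f)

    EndpointOfClass : Fin 8 → Fin 8 → Set
    EndpointOfClass A = EndpointOf Htree (class A)

    y-endpoint : ∀ s i → EndpointOfClass (colour s (y i)) (vP i)
    y-endpoint s i = y i , ∈-class s (y i) , inj₁ (y-left i)

    even-crossings : ∀ s e f → colour s e ≢ colour s f →
                     ∀ {u v vs es} → EndpointOfClass (colour s e) u → EndpointOfClass (colour s e) v →
                     IsPath Htree u v vs es → EvenN (count (class (colour s f)) es)
    even-crossings s e f e≢f {u} {v} u∈ v∈ path =
      -- Both colours lie on side `s` by `side-end`, so being distinct they fall under `same-side`.
      proj₂ (same-side _ _ (trans (side-end s (g e)) (sym (side-end s (g f)))) e≢f)
        u v u∈ v∈ _ _ path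

  -- Otherwise Pᵢ and B are both endpoints of edges coloured like yᵢ, while the path between them
  -- crosses the colour of xᵢ exactly once.
  inward : ∀ i f → proj₁ (Hends f) ≡ vB → Inward (g (x i)) (g (y i)) (g f)
  inward i f f-left s y≡f = decidable-stable (_ ≟ _) λ x≢y →
    ¬even-1 (subst EvenN (count-∈ (∈-class s (x i)))
      (even-crossings s (y i) (x i) (≢-sym x≢y) (y-endpoint s i)
        (subst (λ A → EndpointOfClass A vB) (sym y≡f) (f , ∈-class s f , inj₁ f-left))
        (vP→vB i)))

  private
    same-colour : ∀ s e f → f ∈ class (colour s e) → colour s e ≡ colour s f
    same-colour s e f f∈ = trans (sym (class-unique _ f f∈))
      (cong (λ t → colour t f) (side-end s (g e)))

    -- If xᵢ and xⱼ had different colours, the path from Pᵢ through B to Pⱼ would cross the colour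
    -- of xᵢ only once, although both its ends meet the common colour of yᵢ and yⱼ.
    parallel-crossed : ∀ {i j} → i ≢ j → ∀ s → colour s (y i) ≡ colour s (y j) →
                       colour s (y i) ≢ colour s (x i) → colour s (x i) ≡ colour s (x j)
    parallel-crossed {i} {j} i≢j s yi≡yj y≢x = decidable-stable (_ ≟ _) λ xi≢xj →
      ¬even-1 (subst EvenN (count-∈-∉ (∈-class s (x i)) (xi≢xj ∘ same-colour s (x i) (x j)))
        (even-crossings s (y i) (x i) y≢x (y-endpoint s i)
          (subst (λ A → EndpointOfClass A (vP j)) (sym yi≡yj) (y-endpoint s j))
          (vP→vP i≢j)))

  -- Parity applies from whichever leg has two colours; if neither leg does, equality of the outer
  -- colours passes to the inner ones.
  parallel : ∀ i j → i ≢ j → Parallel (g (x i)) (g (y i)) (g (x j)) (g (y j))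
  parallel i j i≢j s yi≡yj with colour s (y i) ≟ colour s (x i) | colour s (y j) ≟ colour s (x j)
  ... | no y≢x    | _         = parallel-crossed i≢j s yi≡yj y≢x
  ... | yes _     | no y≢x    = sym (parallel-crossed (≢-sym i≢j) s (sym yi≡yj) y≢x)
  ... | yes yi≡xi | yes yj≡xj = trans (sym yi≡xi) (trans yi≡yj yj≡xj)

  legs : ∀ i j → i ≢ j → Legs (g (x i)) (g (y i)) (g (x j)) (g (y j))
  legs i j i≢j =
    map⁺ g-injective (distinct i j i≢j) ,
    inward i (x j) (cong proj₁ (x-ends j)) , inward j (x i) (cong proj₁ (x-ends i)) , parallel i j i≢j
    where
    distinct = from-yes (all? λ i → all? λ j →
      ¬? (i ≟ j) →-dec unique? (x i ∷ y i ∷ x j ∷ y j ∷ []))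

  stem : ∀ i → Stem (g BD) (g (x i)) (g (y i))
  stem i = map⁺ g-injective (distinct i) , inward i BD refl
    where
    distinct = from-yes (all? λ i → unique? (BD ∷ x i ∷ y i ∷ []))

  no-separated-colouring : ⊥
  no-separated-colouring = no-labelling _ _ _ _ (legs 0F 1F λ ())
    _ _ (legs 0F 2F λ ()) (legs 1F 2F λ ()) _ (stem 0F) (stem 1F) (stem 2F)

theorem1 : Unfriendly Gtree Htree
theorem1 (h , (h-injective , h-surjective) , realizable) =
  no-separated-colouring g
    (λ {e} {f} ge≡gf → trans (sym (h∘g e)) (trans (cong h ge≡gf) (h∘g f)))
    (λ A → image h (δ Gtree A))
    (λ s f → ∈-image⁺ h-injective h∘g (δ Gtree (end s (g f))) f (∈δ-end s (g f)))
    (λ A f f∈ → end-unique A (g f) (∈-image⁻ h-injective h∘g (δ Gtree A) f f∈))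
    -- Realizability asks for an explicit even path, which the search in G supplies.
    (λ A B same A≢B → let (vs , es , path) , even = same-side⇒even-path A B same
                      in proj₁ (realizable A B A≢B vs es path even))
  where
  g : Fin 7 → Fin 7
  g = proj₁ ∘ h-surjective

  h∘g : ∀ f → h (g f) ≡ f
  h∘g f = proj₂ (h-surjective f) refl
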